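{- Let $\mathcal{H}$ be a family of connected graphs. Then the following are equivalent. (i) There exists a constant $c_1=c_1(\mathcal{H})$ such that $\mathrm{cc}(G)\le c_1$ for every connected $\mathcal{H}$-free graph $G$. (ii) There exists a constant $c_2=c_2(\mathcal{H})$ such that $\mathrm{cp}(G)\le c_2$ for every connected $\mathcal{H}$-free graph $G$. (iii) There is an integer $n\ge 2$ such that $\mathcal{H}\le\{K_{1,n},K^{*}_{n},P_n\}$.
   Context: All graphs are finite, simple and undirected. $C_i$ ($i\ge3$) is the cycle on $i$ vertices, $K_n$ the complete graph and $P_n$ the path on $n$ vertices. A cycle cover of a graph $G$ is a family $\mathcal{P}$ of subgraphs of $G$ (not necessarily induced), each isomorphic to a member of $\{K_1,K_2\}\cup\{C_i:i\ge3\}$, such that $\bigcup_{P\in\mathcal{P}}V(P)=V(G)$; it is a cycle partition if moreover its elements are pairwise vertex-disjoint. $\mathrm{cc}(G)$ (resp. $\mathrm{cp}(G)$) is the minimum cardinality of a cycle cover (resp. cycle partition) of $G$. A graph $G$ is $H$-free if $G$ contains no induced subgraph isomorphic to $H$; for a family $\mathcal{H}$ of graphs, $G$ is $\mathcal{H}$-free if it is $H$-free for every $H\in\mathcal{H}$. For two families $\mathcal{H}_1,\mathcal{H}_2$ of graphs, $\mathcal{H}_1\le\mathcal{H}_2$ means that for every $H_2\in\mathcal{H}_2$ there exists $H_1\in\mathcal{H}_1$ such that $H_1$ is (isomorphic to) an induced subgraph of $H_2$. $K_{1,n}$ is the star with $n$ leaves (order $n+1$). $K^{*}_n$ is the graph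 with vertex set $\{x_i,y_i:1\le i\le n\}$ and edge set $\{x_ix_j:1\le i<j\le n\}\cup\{x_iy_i:1\le i\le n\}$. -}

module Defs where

open import Data.Fin using (Fin; zero; suc; toℕ; splitAt)
open import Data.Fin.Properties using () renaming (_≟_ to _≟ᶠ_)
open import Data.Nat using (ℕ; suc; _+_; _≤_)
open import Data.Nat.Properties using () renaming (_≟_ to _≟ⁿ_)
open import Data.Product using (∃-syntax; _×_; _,_)
open import Data.Sum using (_⊎_; inj₁; inj₂; swap)
open import Data.Unit using (⊤; tt)
open import Data.Empty using (⊥)
open import Function using (_∘_; _⇔_; Injective)
open import Level using (Level; 0ℓ)
open import Relation.Binary
  using (Rel; Symmetric; Irreflexive; Decidable)
open import Relation.Binary.Construct.Closure.ReflexiveTransitive using (Star)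
open import Relation.Binary.PropositionalEquality using (_≡_; _≢_; sym)
open import Relation.Nullary using (¬_; yes; no)
open import Relation.Nullary.Decidable using (_×-dec_; _⊎-dec_; ¬?)
open import Relation.Unary using (Pred; _∈_) renaming (_⊥_ to _DisjointFrom_)

private variable
  ℓ ℓ₁ ℓ₂ : Level

record Graph : Set₁ where
  field
    order  : ℕ
    Adj    : Rel (Fin order) 0ℓ
    adj?   : Decidable Adj
    symm   : Symmetric Adj
    irrefl : Irreflexive _≡_ Adj

  Vertex : Set
  Vertex = Fin order

open Graph

-- The null graph is not connected.
Connected : Graph → Set
Connected G = Vertex G × (∀ u v → Star (Adj G) u v)

-- The simple graph obtained from R by forgetting directions and loops.
fromRel : ∀ n (R : Rel (Fin n) 0ℓ) → Decidable R → Graph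
fromRel n R R? = record
  { order  = n
  ; Adj    = λ u v → u ≢ v × (R u v ⊎ R v u)
  ; adj?   = λ u v → ¬? (u ≟ᶠ v) ×-dec (R? u v ⊎-dec R? v u)
  ; symm   = λ (u≢v , r) → (u≢v ∘ sym) , swap r
  ; irrefl = λ u≡v (u≢v , _) → u≢v u≡v
  }

K : ℕ → Graph
K n = fromRel n (λ _ _ → ⊤) (λ _ _ → yes tt)

-- The path on n vertices.
P : ℕ → Graph
P n = fromRel n (λ u v → toℕ v ≡ suc (toℕ u)) (λ u v → toℕ v ≟ⁿ suc (toℕ u))

-- The cycle on n vertices; used only for n ≥ 3.
C : ℕ → Graph
C n = fromRel n
  (λ u v → toℕ v ≡ suc (toℕ u) ⊎ (toℕ u ≡ 0 × suc (toℕ v) ≡ n))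
  (λ u v → (toℕ v ≟ⁿ suc (toℕ u)) ⊎-dec ((toℕ u ≟ⁿ 0) ×-dec (suc (toℕ v) ≟ⁿ n)))

-- The star with n leaves; its centre is the vertex zero.
K₁,_ : ℕ → Graph
K₁, n = fromRel (suc n) (λ u _ → u ≡ zero) (λ u _ → u ≟ᶠ zero)

-- In K* n the vertices xᵢ and yᵢ are encoded by splitAt n as inj₁ i and inj₂ i.
K*-edge : ∀ {n} → Rel (Fin n ⊎ Fin n) 0ℓ
K*-edge (inj₁ _) (inj₁ _) = ⊤
K*-edge (inj₁ i) (inj₂ j) = i ≡ j
K*-edge (inj₂ _) _        = ⊥

K*-edge? : ∀ {n} → Decidable (K*-edge {n})
K*-edge? (inj₁ _) (inj₁ _) = yes tt
K*-edge? (inj₁ i) (inj₂ j) = i ≟ᶠ j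
K*-edge? (inj₂ _) _        = no λ ()

K* : ℕ → Graph
K* n = fromRel (n + n)
  (λ u v → K*-edge (splitAt n u) (splitAt n v))
  (λ u v → K*-edge? (splitAt n u) (splitAt n v))

record Subgraph (G : Graph) : Set₁ where
  field
    V      : Pred (Vertex G) 0ℓ
    E      : Rel (Vertex G) 0ℓ
    E-symm : Symmetric E
    E⇒Adj  : ∀ {u v} → E u v → Adj G u v
    E⇒V    : ∀ {u v} → E u v → u ∈ V

open Subgraph

induced : (G : Graph) → Pred (Vertex G) 0ℓ → Subgraph G
induced G S = record
  { V      = S
  ; E      = λ u v → u ∈ S × v ∈ S × Adj G u v
  ; E-symm = λ (u∈S , v∈S , uv) → v∈S , u∈S , symm G uv
  ; E⇒Adj  = λ (_ , _ , uv) → uv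
  ; E⇒V    = λ (u∈S , _) → u∈S
  }

infix 4 _≅_ _⊑_ _≼_

record _≅_ (F : Graph) {G : Graph} (H : Subgraph G) : Set where
  field
    to        : Vertex F → Vertex G
    injective : Injective _≡_ _≡_ to
    image     : ∀ x → x ∈ V H ⇔ (∃[ i ] to i ≡ x)
    edges     : ∀ i j → Adj F i j ⇔ E H (to i) (to j)

-- H is isomorphic to an induced subgraph of G.
_⊑_ : Graph → Graph → Set₁
H ⊑ G = ∃[ S ] H ≅ induced G S

Family : ∀ ℓ → Set _
Family ℓ = Pred Graph ℓ

_-Free : Family ℓ → Graph → Set _
(𝓗 -Free) G = ∀ H → H ∈ 𝓗 → ¬ (H ⊑ G)

_≼_ : Family ℓ₁ → Family ℓ₂ → Set _
𝓗₁ ≼ 𝓗₂ = ∀ H₂ → H₂ ∈ 𝓗₂ → ∃[ H₁ ] H₁ ∈ 𝓗₁ × H₁ ⊑ H₂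

data Piece : Graph → Set₁ where
  K₁    : Piece (K 1)
  K₂    : Piece (K 2)
  cycle : ∀ i → 3 ≤ i → Piece (C i)

-- The index k is the cardinality of the cover. Repeated members are not excluded;
-- they do not affect the minimum taken below.
record CycleCover (G : Graph) (k : ℕ) : Set₁ where
  field
    member : Fin k → Subgraph G
    piece  : ∀ a → ∃[ F ] Piece F × F ≅ member a
    covers : ∀ x → ∃[ a ] x ∈ V (member a)

record CyclePartition (G : Graph) (k : ℕ) : Set₁ where
  field
    cover : CycleCover G k
  open CycleCover cover public
  field
    disjoint : ∀ {a b} → a ≢ b → V (member a) DisjointFrom V (member b)

IsMinimum : Pred ℕ ℓ → ℕ → Set _
IsMinimum Q k = Q k × (∀ j → Q j → k ≤ j)

-- The invariants cc and cp as functional relations: k IsCcOf G means cc(G) = k.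
_IsCcOf_ _IsCpOf_ : ℕ → Graph → Set₁
k IsCcOf G = IsMinimum (CycleCover G) k
k IsCpOf G = IsMinimum (CyclePartition G) k

{-# OPTIONS --safe #-}
module Submission where

-- The implication from (ii) to (i) holds because a cycle partition is a cycle
-- cover.
--
-- From (i) to (iii): a leaf lies on no cycle, and a path contains no cycle. A
-- piece that is not a cycle has at most two vertices, so a cover of a star with
-- n leaves, of K* n or of P n by k pieces satisfies n ≤ 2k
-- (offCycles-count). For n large these connected graphs are therefore not
-- 𝓗-free.
--
-- From (iii) to (ii): a connected graph G omitting K₁,n, K*_n and P_n has
-- independence number α bounded in terms of n alone, and then the argument of
-- Pósa partitions G into at most α pieces.
--
-- The bound on α. As P_n is omitted, G is the ball of radius n around any of its
-- vertices (P-free⇒Ball-total), and it suffices to show that α stays bounded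
-- when a set S is enlarged to its closed neighbourhood N[S]
-- (α-neighbourhood≤). Let Z be an independent set in N[S] outside S. As the
-- star is omitted, a vertex of S has boundedly many neighbours in Z, so the
-- number of vertices of S needed to dominate Z grows with Z. Discarding
-- redundant vertices of S, each remaining one has a private neighbour in Z
-- (private-matching). By Ramsey's theorem many such pairs contain either n
-- pairs with pairwise adjacent vertices in S, which induce K*_n, or more
-- independent vertices in S than there can be.
--
-- Pósa's argument (pósa). Let v be the end of a path that cannot be extended
-- at v. All neighbours of v lie on the path, so the segment from v to its last
-- neighbour spans a cycle (or an edge, or a vertex) containing v and all its
-- neighbours. Deleting that segment lowers α, since v can be added to every
-- independent set of the rest.

open import Defs
open import Axiom.ExcludedMiddle using (ExcludedMiddle)
open import Data.Nat using (ℕ; _≤_)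
open import Data.Product using (∃-syntax; _×_)
open import Function using (_⇔_)
open import Level using (0ℓ; _⊔_) renaming (suc to lsuc)
open import Relation.Unary using (_∈_; _∪_; ｛_｝)

open import Data.Empty using (⊥-elim)
open import Data.Fin using (Fin; zero; suc; toℕ; fromℕ; fromℕ<; inject₁; inject≤; splitAt; join; combine; _↑ˡ_; _↑ʳ_)
open import Data.Fin.Induction using (<-weakInduction)
open import Data.Fin.Properties using (toℕ-injective; toℕ-fromℕ; toℕ-fromℕ<; toℕ-inject₁; toℕ<n; injective⇒≤; combine-injective; inject≤-injective; splitAt-↑ʳ; splitAt⁻¹-↑ˡ; splitAt-join; join-splitAt; ↑ʳ-injective; any?) renaming (_≟_ to _≟ᶠ_)
open import Data.List using (List; []; _∷_; _++_; length; lookup; filter; map; allFin)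
open import Data.List.Membership.Propositional using (find; lose) renaming (_∈_ to _∈ˡ_; _∉_ to _∉ˡ_)
open import Data.List.Membership.Propositional.Properties using (∈-lookup; ∈-allFin; ∈-filter⁺; ∈-filter⁻)
open import Data.List.Properties using (length-map)
open import Data.List.Relation.Binary.Sublist.Propositional using (_⊆_; []; _∷_; _∷ʳ_; ⊆-trans; minimum)
open import Data.List.Relation.Binary.Sublist.Propositional.Properties using (All-resp-⊆; filter-⊆)
open import Data.List.Relation.Unary.All as All using (All; []; _∷_)
open import Data.List.Relation.Unary.All.Properties using (all-filter; ¬All⇒Any¬; ++⁻ˡ) renaming (map⁺ to All-map⁺)
open import Data.List.Relation.Unary.AllPairs as AllPairs using (AllPairs; []; _∷_)
open import Data.List.Relation.Unary.AllPairs.Properties using () renaming (map⁺ to AllPairs-map⁺)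
open import Data.List.Relation.Unary.Any as Any using (Any; here; there; index)
open import Data.List.Relation.Unary.Any.Properties using (lookup-index)
open import Data.List.Relation.Unary.Linked using (Linked; []; [-]; _∷_)
open import Data.List.Relation.Unary.Unique.Propositional using (Unique)
open import Data.Nat using (zero; suc; _+_; _*_; _<_; z≤n; s≤s; _≤?_)
open import Data.Nat.Properties
open import Data.Product using (Σ; ∃; _,_; proj₁; proj₂)
open import Data.Sum using (_⊎_; inj₁; inj₂; [_,_]′)
open import Data.Unit using (tt)
open import Function using (_∘_; Injective; mk⇔)
open import Function.Bundles using (Equivalence)
open import Level using (Lift; lift; lower)
open import Relation.Binary using (Rel; Symmetric; tri<; tri≈; tri>) renaming (Decidable to Decidable₂)
open import Relation.Binary.Construct.Closure.ReflexiveTransitive using (Star; ε; _◅_; _◅◅_; reverse)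
open import Relation.Binary.PropositionalEquality using (_≡_; _≢_; refl; sym; trans; cong; cong₂; subst; subst₂)
open import Relation.Nullary using (¬_; Dec; yes; no; contradiction)
open import Relation.Nullary.Decidable using (map′; ¬?; _×-dec_; _⊎-dec_; decidable-stable)
open import Relation.Unary using (Pred; Decidable; U)

open Graph
open Subgraph
open _≅_
open Equivalence using () renaming (to to fwd; from to bwd)

-- Least witnesses

lowerEM : ∀ {a} b → ExcludedMiddle (a ⊔ b) → ExcludedMiddle a
lowerEM b em {A} = map′ lower lift (em {Lift b A})

least : ∀ {q} {Q : Pred ℕ q} → Decidable Q → ∀ {n} → Q n → ∃[ k ] IsMinimum Q k × k ≤ n
least {Q = Q} Q? {n} qn =
  [ (λ (k , min) → k , min , proj₂ min n qn)
  , (λ none → ⊥-elim (none n ≤-refl qn))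
  ]′ (search (suc n))
  where
  search : ∀ m → ∃ (IsMinimum Q) ⊎ (∀ j → j < m → ¬ Q j)
  search zero = inj₂ λ _ ()
  search (suc m) with search m
  ... | inj₁ found = inj₁ found
  ... | inj₂ none with Q? m
  ...   | yes qm = inj₁ (m , qm , λ j qj → ≮⇒≥ λ j<m → none j j<m qj)
  ...   | no ¬qm = inj₂ λ j j<1+m qj →
    [ (λ j<m → none j j<m qj) , (λ { refl → ¬qm qj }) ]′ (m<1+n⇒m<n∨m≡n j<1+m)

-- Induced subgraphs as embeddings

-- An injection of vertices preserving and reflecting adjacency. Its existence
-- is equivalent to F ⊑ G, but it does not mention the set of image vertices.
record _↪_ (F G : Graph) : Set where
  field
    emap   : Vertex F → Vertex G
    einj   : Injective _≡_ _≡_ emap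
    eedges : ∀ i j → Adj F i j ⇔ Adj G (emap i) (emap j)

infix 4 _↪_

open _↪_

⊑⇒↪ : ∀ {F G} → F ⊑ G → F ↪ G
⊑⇒↪ (S , iso) = record
  { emap   = to iso
  ; einj   = injective iso
  ; eedges = λ i j → mk⇔
      (λ ij → proj₂ (proj₂ (fwd (edges iso i j) ij)))
      (λ ij → bwd (edges iso i j) (bwd (image iso _) (i , refl) , bwd (image iso _) (j , refl) , ij))
  }

↪⇒⊑ : ∀ {F G} → F ↪ G → F ⊑ G
↪⇒⊑ e = (λ x → ∃[ i ] emap e i ≡ x) , record
  { to        = emap e
  ; injective = einj e
  ; image     = λ x → mk⇔ (λ p → p) (λ p → p)
  ; edges     = λ i j → mk⇔
      (λ ij → (i , refl) , (j , refl) , fwd (eedges e i j) ij)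
      (λ (_ , _ , ij) → bwd (eedges e i j) ij)
  }

⊑-trans : ∀ {F G H} → F ⊑ G → G ⊑ H → F ⊑ H
⊑-trans F⊑G G⊑H = ↪⇒⊑ (record
  { emap   = emap g ∘ emap f
  ; einj   = einj f ∘ einj g
  ; eedges = λ i j → mk⇔
      (fwd (eedges g _ _) ∘ fwd (eedges f i j))
      (bwd (eedges f i j) ∘ bwd (eedges g _ _))
  })
  where f = ⊑⇒↪ F⊑G
        g = ⊑⇒↪ G⊑H

-- Vertices lying on no cycle

-- x lies on no cycle of G, induced or not.
OffCycles : (G : Graph) → Vertex G → Set₁
OffCycles G x = ∀ {m} → 3 ≤ m → (H : Subgraph G) → C m ≅ H → ¬ (x ∈ V H)

-- Each vertex f i is encoded by a piece containing it and its position in that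
-- piece, one of at most two since the piece is not a cycle.
offCycles-count : ∀ {G k n} (f : Fin n → Vertex G) → Injective _≡_ _≡_ f →
  (∀ i → OffCycles G (f i)) → CycleCover G k → n ≤ k * 2
offCycles-count {G} {k} {n} f f-inj off cover = injective⇒≤ code-injective
  where
  open CycleCover cover

  -- Enumerates the vertices f i of the piece a; its values on a cycle are
  -- irrelevant.
  decode : ∀ a → ∃[ d ] (∀ i → f i ∈ V (member a) → ∃[ b ] d b ≡ f i)
  decode a with piece a
  ... | _ , K₁ , iso = (λ (_ : Fin 2) → to iso zero) , λ i i∈ → hit i (fwd (image iso _) i∈)
    where
    hit : ∀ i → ∃[ b ] to iso b ≡ f i → ∃[ b ] to iso zero ≡ f i
    hit i (zero , eq) = zero , eq
  ... | _ , K₂ , iso = to iso , λ i i∈ → fwd (image iso _) i∈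
  ... | _ , cycle m 3≤m , iso = (λ _ → to iso (fromℕ< (≤-trans (s≤s z≤n) 3≤m))) ,
    λ i i∈ → ⊥-elim (off i 3≤m (member a) iso i∈)

  hits : ∀ i → ∃[ a ] ∃[ b ] proj₁ (decode a) b ≡ f i
  hits i = let a , i∈ = covers (f i) ; b , eq = proj₂ (decode a) i i∈ in a , b , eq

  code : Fin n → Fin (k * 2)
  code i = combine (proj₁ (hits i)) (proj₁ (proj₂ (hits i)))

  code-injective : Injective _≡_ _≡_ code
  code-injective {i} {j} eq =
    let _ , _ , decode-i = hits i
        _ , _ , decode-j = hits j
        a≡a′ , b≡b′ = combine-injective _ _ _ _ eq
    in f-inj (trans (sym decode-i) (trans (cong₂ (λ a → proj₁ (decode a)) a≡a′ b≡b′) decode-j))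

C-neighbours : ∀ {m} → 3 ≤ m → (u : Fin m) → ∃[ v ] ∃[ w ] v ≢ w × Adj (C m) u v × Adj (C m) u w
C-neighbours {suc (suc (suc m))} (s≤s (s≤s (s≤s _))) zero = suc zero , fromℕ (suc (suc m)) , (λ ()) ,
  ((λ ()) , inj₁ (inj₁ refl)) ,
  ((λ ()) , inj₁ (inj₂ (refl , cong (λ k → suc (suc (suc k))) (toℕ-fromℕ m))))
C-neighbours {suc (suc (suc m))} (s≤s (s≤s (s≤s _))) (suc u) with suc (toℕ (suc u)) ≟ suc (suc (suc m))
-- The last vertex of the cycle, adjacent to its predecessor and to zero.
... | yes last = inject₁ u , zero ,
  (λ eq → contradiction (trans (sym (toℕ-inject₁ u)) (cong toℕ eq)) λ u≡0 →
    contradiction (trans (cong (λ k → suc (suc k)) (sym u≡0)) last) λ ()) ,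
  (pred≢ , inj₂ (inj₁ (cong suc (sym (toℕ-inject₁ u))))) ,
  ((λ ()) , inj₂ (inj₂ (refl , last)))
  where
  pred≢ : suc u ≢ inject₁ u
  pred≢ eq = 1+n≢n (trans (cong toℕ eq) (toℕ-inject₁ u))
... | no ¬last = inject₁ u , fromℕ< next< ,
  (λ eq → m≢1+n+m (toℕ u) {1} (trans (trans (sym (toℕ-inject₁ u)) (cong toℕ eq)) next≡)) ,
  (pred≢ , inj₂ (inj₁ (cong suc (sym (toℕ-inject₁ u))))) ,
  ((λ eq → 1+n≢n (sym (trans (cong toℕ eq) next≡))) , inj₁ (inj₁ next≡))
  where
  next< : suc (toℕ (suc u)) < suc (suc (suc m))
  next< = ≤∧≢⇒< (toℕ<n (suc u)) ¬last
  next≡ : toℕ (fromℕ< next<) ≡ suc (toℕ (suc u))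
  next≡ = toℕ-fromℕ< next<
  pred≢ : suc u ≢ inject₁ u
  pred≢ eq = 1+n≢n (trans (cong toℕ eq) (toℕ-inject₁ u))

-- x has at most one neighbour.
Leaf : (G : Graph) → Vertex G → Set
Leaf G x = ∀ {v w} → Adj G x v → Adj G x w → v ≡ w

leaf⇒offCycles : ∀ {G x} → Leaf G x → OffCycles G x
leaf⇒offCycles {G} leaf 3≤m H iso x∈H with fwd (image iso _) x∈H
... | u , refl with C-neighbours 3≤m u
...   | v , w , v≢w , uv , uw = v≢w (injective iso (leaf (adj uv) (adj uw)))
  where
  adj : ∀ {i j} → Adj (C _) i j → Adj G (to iso i) (to iso j)
  adj ij = E⇒Adj H (fwd (edges iso _ _) ij)

-- Of the two neighbours on a cycle in a path at least one is the predecessor,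
-- so the cycle could be followed downwards for ever.
P-offCycles : ∀ {n} (x : Fin n) → OffCycles (P n) x
P-offCycles {n} x {m} 3≤m H iso x∈H =
  let i , _ = fwd (image iso x) x∈H in descend _ i ≤-refl
  where
  adj : ∀ {i j} → Adj (C m) i j → Adj (P n) (to iso i) (to iso j)
  adj ij = E⇒Adj H (fwd (edges iso _ _) ij)

  descend : ∀ d i → ¬ (toℕ (to iso i) < d)
  descend (suc d) i (s≤s i≤d) with C-neighbours 3≤m i
  ... | v , w , v≢w , iv , iw with adj iv | adj iw
  ...   | _ , inj₂ i≡1+v | _ = descend d v (subst (_≤ d) i≡1+v i≤d)
  ...   | _ , inj₁ _ | _ , inj₂ i≡1+w = descend d w (subst (_≤ d) i≡1+w i≤d)
  ...   | _ , inj₁ v≡1+i | _ , inj₁ w≡1+i = v≢w (injective iso (toℕ-injective (trans v≡1+i (sym w≡1+i))))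

-- Connectedness and leaves of the three unavoidable graphs

rooted⇒connected : ∀ G (r : Vertex G) → (∀ v → Star (Adj G) r v) → Connected G
rooted⇒connected G r reach = r , λ u v → reverse (symm G) (reach u) ◅◅ reach v

K₁,-connected : ∀ n → Connected (K₁, n)
K₁,-connected n = rooted⇒connected (K₁, n) zero λ where
  zero    → ε
  (suc i) → ((λ ()) , inj₁ refl) ◅ ε

K₁,-leaf : ∀ {n} (i : Fin n) → Leaf (K₁, n) (suc i)
K₁,-leaf i (_ , inj₂ refl) (_ , inj₂ refl) = refl

P-connected : ∀ n → Connected (P (suc n))
P-connected n = rooted⇒connected (P (suc n)) zero (<-weakInduction _ ε step)
  where
  step : ∀ i → Star (Adj (P (suc n))) zero (inject₁ i) → Star (Adj (P (suc n))) zero (suc i)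
  step i path = path ◅◅ (distinct , inj₁ (cong suc (sym (toℕ-inject₁ i)))) ◅ ε
    where
    distinct : inject₁ i ≢ suc i
    distinct eq = 1+n≢n (trans (sym (cong toℕ eq)) (toℕ-inject₁ i))

-- Adjacency in K* n with xᵢ named inj₁ i and yᵢ named inj₂ i.
K*-adj : ∀ {n} {s t : Fin n ⊎ Fin n} → s ≢ t → K*-edge s t → Adj (K* n) (join n n s) (join n n t)
K*-adj {n} {s} {t} s≢t e =
  (λ eq → s≢t (trans (sym (splitAt-join n n s)) (trans (cong (splitAt n) eq) (splitAt-join n n t)))) ,
  inj₁ (subst₂ K*-edge (sym (splitAt-join n n s)) (sym (splitAt-join n n t)) e)

K*-connected : ∀ n → Connected (K* (suc n))
K*-connected n = rooted⇒connected (K* m) zero λ v →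
  subst (Star (Adj (K* m)) zero) (join-splitAt m m v) (reach (splitAt m v))
  where
  m = suc n
  clique : ∀ i → Star (Adj (K* m)) zero (i ↑ˡ m)
  clique zero    = ε
  clique (suc i) = K*-adj {m} {inj₁ zero} {inj₁ (suc i)} (λ ()) tt ◅ ε

  reach : ∀ s → Star (Adj (K* m)) zero (join m m s)
  reach (inj₁ i) = clique i
  reach (inj₂ i) = clique i ◅◅ K*-adj {m} {inj₁ i} {inj₂ i} (λ ()) refl ◅ ε

K*-leaf : ∀ {n} (i : Fin n) → Leaf (K* n) (n ↑ʳ i)
K*-leaf {n} i {v} {w} iv iw = trans (only v iv) (sym (only w iw))
  where
  only : ∀ v → Adj (K* n) (n ↑ʳ i) v → v ≡ i ↑ˡ n
  only v (_ , e) rewrite splitAt-↑ʳ n n i with splitAt n v in eq | e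
  ... | inj₁ j | inj₂ refl = sym (splitAt⁻¹-↑ˡ eq)
  ... | inj₁ j | inj₁ ()
  ... | inj₂ j | inj₁ ()
  ... | inj₂ j | inj₂ ()

-- Lists and their pairwise relations

lookup-consecutive : ∀ {A : Set} {R : Rel A 0ℓ} {xs} → Linked R xs →
  ∀ i j → toℕ j ≡ suc (toℕ i) → R (lookup xs i) (lookup xs j)
lookup-consecutive (r ∷ _) zero (suc zero) refl = r
lookup-consecutive (_ ∷ rs) (suc i) (suc j) eq = lookup-consecutive rs i j (suc-injective eq)

AllPairs-lookup : ∀ {A : Set} {R : Rel A 0ℓ} {xs} → Symmetric R → AllPairs R xs →
  ∀ i j → i ≢ j → R (lookup xs i) (lookup xs j)
AllPairs-lookup sy (px ∷ _) zero zero i≢j = contradiction refl i≢j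
AllPairs-lookup sy (px ∷ _) zero (suc j) _ = All.lookup px (∈-lookup j)
AllPairs-lookup sy (px ∷ _) (suc i) zero _ = sy (All.lookup px (∈-lookup i))
AllPairs-lookup sy (_ ∷ ps) (suc i) (suc j) i≢j = AllPairs-lookup sy ps i j (i≢j ∘ cong suc)

AllPairs-resp-⊆ : ∀ {A : Set} {R : Rel A 0ℓ} {xs ys} → xs ⊆ ys → AllPairs R ys → AllPairs R xs
AllPairs-resp-⊆ [] [] = []
AllPairs-resp-⊆ (_ ∷ʳ s) (_ ∷ ps) = AllPairs-resp-⊆ s ps
AllPairs-resp-⊆ (refl ∷ s) (p ∷ ps) = All-resp-⊆ s p ∷ AllPairs-resp-⊆ s ps

Linked-++⁻ˡ : ∀ {A : Set} {R : Rel A 0ℓ} xs {ys} → Linked R (xs ++ ys) → Linked R xs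
Linked-++⁻ˡ [] _ = []
Linked-++⁻ˡ (x ∷ []) _ = [-]
Linked-++⁻ˡ (x ∷ y ∷ xs) (r ∷ rs) = r ∷ Linked-++⁻ˡ (y ∷ xs) rs

AllPairs-++⁻ˡ : ∀ {A : Set} {R : Rel A 0ℓ} xs {ys} → AllPairs R (xs ++ ys) → AllPairs R xs
AllPairs-++⁻ˡ [] _ = []
AllPairs-++⁻ˡ (x ∷ xs) (p ∷ ps) = ++⁻ˡ xs p ∷ AllPairs-++⁻ˡ xs ps

lookup-injective : ∀ {A : Set} {xs : List A} → Unique xs → Injective _≡_ _≡_ (lookup xs)
lookup-injective u {i} {j} eq = decidable-stable (i ≟ᶠ j)
  λ i≢j → AllPairs-lookup (λ x≢y → x≢y ∘ sym) u i j i≢j eq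

∃lookup⇔∈ : ∀ {A : Set} {xs : List A} {x} → (∃[ i ] lookup xs i ≡ x) ⇔ x ∈ˡ xs
∃lookup⇔∈ = mk⇔ (λ { (i , refl) → ∈-lookup i }) (λ x∈ → index x∈ , sym (lookup-index x∈))

length-filter-split : ∀ {A : Set} {Q : Pred A 0ℓ} (Q? : Decidable Q) xs →
  length xs ≡ length (filter Q? xs) + length (filter (¬? ∘ Q?) xs)
length-filter-split Q? [] = refl
length-filter-split Q? (x ∷ xs) with Q? x
... | yes _ = cong suc (length-filter-split Q? xs)
... | no _  = trans (cong suc (length-filter-split Q? xs)) (sym (+-suc _ _))

-- The prefix of xs ending at the last element that satisfies T; it is empty if
-- there is none.
prefixToLast : ∀ {A : Set} {T : Pred A 0ℓ} → Decidable T → ∀ xs →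
  ∃[ ys ] (∃[ zs ] xs ≡ ys ++ zs)
        × (∀ i → suc (toℕ i) ≡ length ys → T (lookup ys i))
        × (∀ {x} → x ∈ˡ xs → T x → x ∈ˡ ys)
prefixToLast T? [] = [] , ([] , refl) , (λ ()) , λ x∈ _ → x∈
prefixToLast T? (x ∷ xs) with prefixToLast T? xs
... | y ∷ ys , (zs , eq) , last , all = x ∷ y ∷ ys , (zs , cong (x ∷_) eq) ,
  (λ { (suc i) e → last i (suc-injective e) }) ,
  λ { (here e) _ → here e ; (there x∈) t → there (all x∈ t) }
... | [] , _ , _ , all with T? x
...   | yes tx = x ∷ [] , (xs , refl) , (λ { zero _ → tx }) ,
  λ { (here e) _ → here e ; (there x∈) t → there (all x∈ t) }
...   | no ¬tx = [] , (x ∷ xs , refl) , (λ ()) ,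
  λ { (here refl) t → contradiction t ¬tx ; (there x∈) t → all x∈ t }

-- Ramsey's theorem

-- An upper bound for the Ramsey number, given by the recursion of the proof.
ramseyNumber : ℕ → ℕ → ℕ
ramseyNumber zero    b       = 0
ramseyNumber (suc a) zero    = 0
ramseyNumber (suc a) (suc b) = suc (ramseyNumber a (suc b) + ramseyNumber (suc a) b)

-- R need not be symmetric: AllPairs only compares an entry with later ones.
ramsey : ∀ {A : Set} {R : Rel A 0ℓ} → Decidable₂ R → ∀ a b (xs : List A) →
  ramseyNumber a b ≤ length xs →
  (∃[ ys ] ys ⊆ xs × length ys ≡ a × AllPairs R ys) ⊎
  (∃[ ys ] ys ⊆ xs × length ys ≡ b × AllPairs (λ x y → ¬ R x y) ys)
ramsey R? zero    b       xs _ = inj₁ ([] , minimum xs , refl , [])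
ramsey R? (suc a) zero    xs _ = inj₂ ([] , minimum xs , refl , [])
ramsey {R = R} R? (suc a) (suc b) (x ∷ xs) (s≤s r≤)
  with ramseyNumber a (suc b) ≤? length (filter (R? x) xs)
... | yes enough =
  [ (λ (ys , ys⊆ , len , ok) → inj₁
      (x ∷ ys , refl ∷ ⊆-trans ys⊆ (filter-⊆ (R? x) xs) , cong suc len ,
       All-resp-⊆ ys⊆ (all-filter (R? x) xs) ∷ ok))
  , (λ (ys , ys⊆ , len , ok) → inj₂ (ys , x ∷ʳ ⊆-trans ys⊆ (filter-⊆ (R? x) xs) , len , ok))
  ]′ (ramsey R? a (suc b) (filter (R? x) xs) enough)
... | no few =
  [ (λ (ys , ys⊆ , len , ok) → inj₁ (ys , x ∷ʳ ⊆-trans ys⊆ (filter-⊆ ¬R? xs) , len , ok))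
  , (λ (ys , ys⊆ , len , ok) → inj₂
      (x ∷ ys , refl ∷ ⊆-trans ys⊆ (filter-⊆ ¬R? xs) , cong suc len ,
       All-resp-⊆ ys⊆ (all-filter ¬R? xs) ∷ ok))
  ]′ (ramsey R? (suc a) b (filter ¬R? xs) enough)
  where
  ¬R? : Decidable (λ y → ¬ R x y)
  ¬R? = ¬? ∘ R? x

  enough : ramseyNumber (suc a) b ≤ length (filter ¬R? xs)
  enough = ≮⇒≥ λ many →
    <⇒≱ (+-mono-< (≰⇒> few) many) (≤-trans r≤ (≤-reflexive (length-filter-split (R? x) xs)))

-- Independent sets, neighbourhoods and induced stars

module _ (G : Graph) where

  -- The entries of l form an independent set inside S, listed without repetition.
  Independent : Pred (Vertex G) 0ℓ → List (Vertex G) → Set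
  Independent S l = All S l × AllPairs (λ u v → u ≢ v × ¬ Adj G u v) l

  -- α≤ S a: the subgraph induced by S has independence number at most a.
  α≤ : Pred (Vertex G) 0ℓ → ℕ → Set
  α≤ S a = ∀ l → Independent S l → length l ≤ a

  -- The closed neighbourhood of a set.
  N[_] : Pred (Vertex G) 0ℓ → Pred (Vertex G) 0ℓ
  N[ S ] y = S y ⊎ ∃[ x ] S x × Adj G x y

  N[]? : ∀ {S} → Decidable S → Decidable N[ S ]
  N[]? S? y = S? y ⊎-dec any? (λ x → S? x ×-dec adj? G x y)

  -- The vertices at distance at most k from x.
  Ball : Vertex G → ℕ → Pred (Vertex G) 0ℓ
  Ball x zero    = ｛ x ｝
  Ball x (suc k) = N[ Ball x k ]

  Ball? : ∀ x k → Decidable (Ball x k)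
  Ball? x zero    = x ≟ᶠ_
  Ball? x (suc k) = N[]? (Ball? x k)

  -- Dist x y d: the distance from x to y is d.
  Dist : Vertex G → Vertex G → ℕ → Set
  Dist x y = IsMinimum (λ k → Ball x k y)

module _ {G : Graph} where

  independent-filter : ∀ {S T l} (T? : Decidable T) → Independent G S l → Independent G T (filter T? l)
  independent-filter {l = l} T? (_ , ind) = all-filter T? l , AllPairs-resp-⊆ (filter-⊆ T? l) ind

  independent⇒¬adj : ∀ {S l} → Independent G S l → ∀ {u v} → u ∈ˡ l → v ∈ˡ l → ¬ Adj G u v
  independent⇒¬adj {l = l} (_ , ind) {u} {v} u∈ v∈ uv with index u∈ ≟ᶠ index v∈
  ... | yes eq = irrefl G (trans (lookup-index u∈) (trans (cong (lookup l) eq) (sym (lookup-index v∈)))) uv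
  ... | no neq = proj₂ (AllPairs-lookup (λ (n , na) → n ∘ sym , na ∘ symm G) ind (index u∈) (index v∈) neq)
                   (subst₂ (Adj G) (lookup-index u∈) (lookup-index v∈) uv)

  K₁,-free⇒α-neighbours≤ : ∀ {n} → ¬ (K₁, n ↪ G) → ∀ x → α≤ G (Adj G x) n
  K₁,-free⇒α-neighbours≤ {n} free x l ind@(adj , _) = ≮⇒≥ λ n<l → free (star (<⇒≤ n<l))
    where
    star : n ≤ length l → K₁, n ↪ G
    star n≤l = record { emap = f ; einj = f-inj ; eedges = f-edges }
      where
      leaf : Fin n → Vertex G
      leaf i = lookup l (inject≤ i n≤l)

      x-leaf : ∀ i → Adj G x (leaf i)
      x-leaf i = All.lookup adj (∈-lookup (inject≤ i n≤l))

      f : Fin (suc n) → Vertex G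
      f zero    = x
      f (suc i) = leaf i

      f-inj : Injective _≡_ _≡_ f
      f-inj {zero}  {zero}  _  = refl
      f-inj {zero}  {suc j} eq = ⊥-elim (irrefl G eq (x-leaf j))
      f-inj {suc i} {zero}  eq = ⊥-elim (irrefl G (sym eq) (x-leaf i))
      f-inj {suc i} {suc j} eq = cong suc
        (inject≤-injective n≤l n≤l i j (lookup-injective (AllPairs.map proj₁ (proj₂ ind)) eq))

      f-edges : ∀ i j → Adj (K₁, n) i j ⇔ Adj G (f i) (f j)
      f-edges zero    zero    = mk⇔ (λ (0≢0 , _) → contradiction refl 0≢0) (λ xx → ⊥-elim (irrefl G refl xx))
      f-edges zero    (suc j) = mk⇔ (λ _ → x-leaf j) (λ _ → (λ ()) , inj₁ refl)
      f-edges (suc i) zero    = mk⇔ (λ _ → symm G (x-leaf i)) (λ _ → (λ ()) , inj₂ refl)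
      f-edges (suc i) (suc j) = mk⇔ (λ { (_ , inj₁ ()) ; (_ , inj₂ ()) })
        (λ ij → ⊥-elim (independent⇒¬adj ind (∈-lookup (inject≤ i n≤l)) (∈-lookup (inject≤ j n≤l)) ij))

-- Private neighbours and induced copies of K*

  -- Vertices x i forming a clique, with private neighbours y i forming an
  -- independent set, induce K*. Injectivity follows: x i and y j differ because
  -- y i is adjacent to x i but not to y j.
  K*-embedding : ∀ {n} (x y : Fin n → Vertex G) →
    (∀ {i j} → i ≢ j → Adj G (x i) (x j)) →
    (∀ i → Adj G (x i) (y i)) →
    (∀ {i j} → i ≢ j → ¬ Adj G (x i) (y j)) →
    (∀ i j → ¬ Adj G (y i) (y j)) → K* n ↪ G
  K*-embedding {n} x y xx xy ¬xy ¬yy = record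
    { emap   = g ∘ splitAt n
    ; einj   = λ {u} {v} eq → split-inj u v (g-inj (splitAt n u) (splitAt n v) eq)
    ; eedges = λ u v → mk⇔
        (λ (u≢v , e) → [ forth (u≢v ∘ split-inj u v) , symm G ∘ forth (u≢v ∘ sym ∘ split-inj v u) ]′ e)
        (λ uv → (λ { refl → irrefl G refl uv }) , back (splitAt n u) (splitAt n v) uv)
    }
    where
    g : Fin n ⊎ Fin n → Vertex G
    g (inj₁ i) = x i
    g (inj₂ i) = y i

    split-inj : ∀ u v → splitAt n u ≡ splitAt n v → u ≡ v
    split-inj u v eq = trans (sym (join-splitAt n n u)) (trans (cong (join n n) eq) (join-splitAt n n v))

    x≢y : ∀ i j → x i ≢ y j
    x≢y i j eq = ¬yy j i (subst (λ z → Adj G z (y i)) eq (xy i))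

    g-inj : ∀ s t → g s ≡ g t → s ≡ t
    g-inj (inj₁ i) (inj₁ j) eq = cong inj₁ (decidable-stable (i ≟ᶠ j) λ i≢j → irrefl G eq (xx i≢j))
    g-inj (inj₁ i) (inj₂ j) eq = contradiction eq (x≢y i j)
    g-inj (inj₂ i) (inj₁ j) eq = contradiction (sym eq) (x≢y j i)
    g-inj (inj₂ i) (inj₂ j) eq = cong inj₂
      (decidable-stable (i ≟ᶠ j) λ i≢j → ¬xy i≢j (subst (Adj G (x i)) eq (xy i)))

    forth : ∀ {s t} → s ≢ t → K*-edge s t → Adj G (g s) (g t)
    forth {inj₁ i} {inj₁ j} s≢t _    = xx (s≢t ∘ cong inj₁)
    forth {inj₁ i} {inj₂ j} _   refl = xy i

    back : ∀ s t → Adj G (g s) (g t) → K*-edge s t ⊎ K*-edge t s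
    back (inj₁ i) (inj₁ j) _ = inj₁ tt
    back (inj₁ i) (inj₂ j) e = inj₁ (decidable-stable (i ≟ᶠ j) λ i≢j → ¬xy i≢j e)
    back (inj₂ i) (inj₁ j) e = inj₂ (decidable-stable (j ≟ᶠ i) λ j≢i → ¬xy j≢i (symm G e))
    back (inj₂ i) (inj₂ j) e = ⊥-elim (¬yy i j e)

  -- Two pairs whose first vertices differ, whose second vertices are not adjacent,
  -- and neither of whose first vertices is adjacent to the second of the other.
  Private : Rel (Vertex G × Vertex G) 0ℓ
  Private (x , y) (x′ , y′) = x ≢ x′ × ¬ Adj G x y′ × ¬ Adj G x′ y × ¬ Adj G y y′

  private-sym : Symmetric Private
  private-sym (x≢x′ , xy′ , x′y , yy′) = x≢x′ ∘ sym , x′y , xy′ , yy′ ∘ symm G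

  -- If X dominates Y and no vertex has more than m independent neighbours, then
  -- some vertices of X, numbering at least |Y| / m, have private neighbours in Y.
  -- The first vertex x of X is either redundant, or the only vertex of X adjacent
  -- to some y in Y; in the second case x is matched with y, and the neighbours of
  -- x, at most m, are removed from Y.
  private-matching : ∀ {m S} → (∀ x → α≤ G (Adj G x) m) →
    ∀ X Y → Independent G S Y → (∀ {y} → y ∈ˡ Y → Any (λ x → Adj G x y) X) →
    ∃[ ps ] length Y ≤ length ps * m
          × All (λ (x , y) → x ∈ˡ X × y ∈ˡ Y × Adj G x y) ps × AllPairs Private ps
  private-matching nb≤ [] [] ind dom = [] , z≤n , [] , []
  private-matching nb≤ [] (y ∷ Y) ind dom with dom (here refl)
  ... | ()
  private-matching {m} nb≤ (x ∷ X) Y ind dom with All.all? (λ y → Any.any? (λ x → adj? G x y) X) Y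
  ... | yes domX =
    let ps , len , good , priv = private-matching nb≤ X Y ind (All.lookup domX)
    in ps , len , All.map (λ (x∈ , rest) → there x∈ , rest) good , priv
  ... | no ¬domX with find (¬All⇒Any¬ (λ y → Any.any? (λ x → adj? G x y) X) Y ¬domX)
  ...   | y , y∈Y , ¬domy =
    let ps , len , good , priv = private-matching nb≤ X far (independent-filter far? ind) domfar
    in (x , y) ∷ ps
     , ≤-trans (≤-reflexive (length-filter-split (adj? G x) Y))
         (+-mono-≤ (nb≤ x _ (independent-filter (adj? G x) ind)) len)
     , (here refl , y∈Y , xy) ∷ All.map (λ (x∈ , y∈ , xy) → there x∈ , proj₁ (∈-filter⁻ far? y∈) , xy) good
     , All.map (λ {p} → apart {p}) good ∷ priv
    where
    far? : Decidable (λ z → ¬ Adj G x z)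
    far? = ¬? ∘ adj? G x

    far : List (Vertex G)
    far = filter far? Y

    domfar : ∀ {z} → z ∈ˡ far → Any (λ x → Adj G x z) X
    domfar z∈ with ∈-filter⁻ far? z∈
    ... | z∈Y , ¬xz with dom z∈Y
    ...   | here xz = contradiction xz ¬xz
    ...   | there a = a

    xy : Adj G x y
    xy with dom y∈Y
    ... | here xy = xy
    ... | there a = contradiction a ¬domy

    apart : ∀ {(x′ , y′) : Vertex G × Vertex G} →
      x′ ∈ˡ X × y′ ∈ˡ far × Adj G x′ y′ → Private (x , y) (x′ , y′)
    apart (x′∈ , y′∈ , x′y′) with ∈-filter⁻ far? y′∈
    ... | y′∈Y , ¬xy′ =
      (λ { refl → ¬xy′ x′y′ }) , ¬xy′ , (λ x′y → ¬domy (lose x′∈ x′y)) , independent⇒¬adj ind y∈Y y′∈Y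

  -- An independent set in N[S] splits into its part inside S and a part outside,
  -- which S dominates; the summands bound these two parts.
  α-neighbourhood≤ : ∀ {S a m n} → Decidable S → (∀ x → α≤ G (Adj G x) m) → ¬ (K* n ↪ G) →
    α≤ G S a → α≤ G (N[_] G S) (a + ramseyNumber n (suc a) * m)
  α-neighbourhood≤ {S} {a} {m} {n} S? nb≤ free S≤a Y ind =
    ≤-trans (≤-reflexive (length-filter-split S? Y)) (+-mono-≤ (S≤a _ (independent-filter S? ind)) outside≤)
    where
    X : List (Vertex G)
    X = filter S? (allFin (order G))

    Z : List (Vertex G)
    Z = filter (¬? ∘ S?) Y

    dominated : ∀ {y} → y ∈ˡ Z → Any (λ x → Adj G x y) X
    dominated y∈ with ∈-filter⁻ (¬? ∘ S?) y∈
    ... | y∈Y , y∉S with All.lookup (proj₁ ind) y∈Y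
    ...   | inj₁ y∈S = contradiction y∈S y∉S
    ...   | inj₂ (x , x∈S , xy) = lose (∈-filter⁺ S? (∈-allFin x) x∈S) xy

    R : Rel (Vertex G × Vertex G) 0ℓ
    R (x , _) (x′ , _) = Adj G x x′

    few : ∀ ps → All (λ (x , y) → x ∈ˡ X × y ∈ˡ Z × Adj G x y) ps → AllPairs Private ps →
      length ps ≤ ramseyNumber n (suc a)
    few ps good priv = ≮⇒≥ λ r<ps →
      [ clique , stable ]′ (ramsey {R = R} (λ p q → adj? G (proj₁ p) (proj₁ q)) n (suc a) ps (<⇒≤ r<ps))
      where
      clique : ¬ (∃[ qs ] qs ⊆ ps × length qs ≡ n × AllPairs R qs)
      clique (qs , qs⊆ , refl , adj) = free (K*-embedding (proj₁ ∘ lookup qs) (proj₂ ∘ lookup qs)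
        (λ i≢j → AllPairs-lookup (symm G) adj _ _ i≢j)
        (λ i → proj₂ (proj₂ (All.lookup good′ (∈-lookup i))))
        (λ i≢j → proj₁ (proj₂ (AllPairs-lookup private-sym priv′ _ _ i≢j)))
        λ i j → ¬yy i j (i ≟ᶠ j))
        where
        good′ = All-resp-⊆ qs⊆ good
        priv′ = AllPairs-resp-⊆ qs⊆ priv
        ¬yy : ∀ i j → Dec (i ≡ j) → ¬ Adj G (proj₂ (lookup qs i)) (proj₂ (lookup qs j))
        ¬yy i j (yes refl) = irrefl G refl
        ¬yy i j (no i≢j)   = proj₂ (proj₂ (proj₂ (AllPairs-lookup private-sym priv′ _ _ i≢j)))

      stable : ¬ (∃[ qs ] qs ⊆ ps × length qs ≡ suc a × AllPairs (λ p q → ¬ R p q) qs)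
      stable (qs , qs⊆ , len , ¬adj) = 1+n≰n (≤-trans
        (≤-reflexive (sym (trans (length-map proj₁ qs) len))) (S≤a (map proj₁ qs)
        ( All-map⁺ (All.map (λ (x∈ , _) → proj₂ (∈-filter⁻ S? {xs = allFin _} x∈)) (All-resp-⊆ qs⊆ good))
        , AllPairs-map⁺ (AllPairs.zipWith (λ (pr , na) → proj₁ pr , na) (AllPairs-resp-⊆ qs⊆ priv , ¬adj)))))

    outside≤ : length Z ≤ ramseyNumber n (suc a) * m
    outside≤ =
      let ps , len , good , priv = private-matching nb≤ X Z (independent-filter (¬? ∘ S?) ind) dominated
      in ≤-trans len (*-monoˡ-≤ m (few ps good priv))

-- Geodesics and balls

  Ball-mono : ∀ {x j k y} → j ≤ k → Ball G x j y → Ball G x k y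
  Ball-mono {k = zero}  z≤n y∈ = y∈
  Ball-mono {j = j} {k = suc k} j≤ y∈ with m≤n⇒m<n∨m≡n j≤
  ... | inj₁ (s≤s j≤k) = inj₁ (Ball-mono j≤k y∈)
  ... | inj₂ refl = y∈

  -- A geodesic of length d, indexed by the naturals up to d; its values beyond d are irrelevant.
  geodesic : ∀ {x} d y → Dist G x y d →
    Σ (ℕ → Vertex G) λ p → p d ≡ y
      × (∀ {i} → i ≤ d → Dist G x (p i) i)
      × (∀ {i} → i < d → Adj G (p i) (p (suc i)))
  geodesic zero y d = (λ _ → y) , refl , (λ { z≤n → d }) , (λ ())
  geodesic {x} (suc d) y yd@(inj₁ y∈ , minim) = contradiction (minim d y∈) 1+n≰n
  geodesic {x} (suc d) y yd@(inj₂ (u , u∈ , uy) , minim) with geodesic d u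
    (u∈ , λ j u∈j → ≤-pred (minim (suc j) (inj₂ (u , u∈j , uy))))
  ... | p , pd≡u , dist , adj = q , q-top , q-dist , q-adj
    where
    q : ℕ → Vertex G
    q i with i ≤? d
    ... | yes _ = p i
    ... | no  _ = y

    q-low : ∀ {i} → i ≤ d → q i ≡ p i
    q-low {i} i≤d with i ≤? d
    ... | yes _   = refl
    ... | no ¬i≤d = contradiction i≤d ¬i≤d

    q-top : q (suc d) ≡ y
    q-top with suc d ≤? d
    ... | yes d<d = contradiction d<d 1+n≰n
    ... | no _    = refl

    q-dist : ∀ {i} → i ≤ suc d → Dist G x (q i) i
    q-dist {i} i≤ with m≤n⇒m<n∨m≡n i≤
    ... | inj₁ (s≤s i≤d) = subst (λ z → Dist G x z i) (sym (q-low i≤d)) (dist i≤d)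
    ... | inj₂ refl      = subst (λ z → Dist G x z i) (sym q-top) yd

    q-adj : ∀ {i} → i < suc d → Adj G (q i) (q (suc i))
    q-adj (s≤s i≤d) with m≤n⇒m<n∨m≡n i≤d
    ... | inj₁ i<d  = subst₂ (Adj G) (sym (q-low i≤d)) (sym (q-low i<d)) (adj i<d)
    ... | inj₂ refl = subst₂ (Adj G) (sym (trans (q-low i≤d) pd≡u)) (sym q-top) uy

  dist-unique : ∀ {x y d e} → Dist G x y d → Dist G x y e → d ≡ e
  dist-unique (y∈d , d-min) (y∈e , e-min) = ≤-antisym (d-min _ y∈e) (e-min _ y∈d)

  dist-adj : ∀ {x u v d e} → Dist G x u d → Dist G x v e → Adj G u v → e ≤ suc d
  dist-adj (u∈ , _) (_ , min) uv = min _ (inj₂ (_ , u∈ , uv))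

  -- Adjacent vertices have distances from x differing by at most one, so a
  -- geodesic is an induced path.
  geodesic⇒P : ∀ {x y d n} → Dist G x y d → n ≤ suc d → P n ↪ G
  geodesic⇒P {x} {y} {d} {n} yd n≤ with geodesic d y yd
  ... | p , _ , dist , adj = record
    { emap   = p ∘ toℕ
    ; einj   = λ {i} {j} eq → toℕ-injective
        (dist-unique (at i) (subst (λ z → Dist G x z (toℕ j)) (sym eq) (at j)))
    ; eedges = λ i j → mk⇔
        (λ (_ , e) → [ step i j , symm G ∘ step j i ]′ e)
        (λ ij → (λ { refl → irrefl G refl ij }) , back i j ij)
    }
    where
    at : ∀ i → Dist G x (p (toℕ {n} i)) (toℕ i)
    at i = dist (≤-pred (≤-trans (toℕ<n i) n≤))

    step : ∀ (i j : Fin n) → toℕ j ≡ suc (toℕ i) → Adj G (p (toℕ i)) (p (toℕ j))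
    step i j eq = subst (λ k → Adj G (p (toℕ i)) (p k)) (sym eq)
      (adj (≤-pred (≤-trans (subst (_< n) eq (toℕ<n j)) n≤)))

    back : ∀ (i j : Fin n) → Adj G (p (toℕ i)) (p (toℕ j)) → toℕ j ≡ suc (toℕ i) ⊎ toℕ i ≡ suc (toℕ j)
    back i j ij with <-cmp (toℕ i) (toℕ j)
    ... | tri< i<j _ _ = inj₁ (≤-antisym (dist-adj (at i) (at j) ij) i<j)
    ... | tri≈ _ i≡j _ = ⊥-elim (irrefl G (cong p i≡j) ij)
    ... | tri> _ _ j<i = inj₂ (≤-antisym (dist-adj (at j) (at i) (symm G ij)) j<i)

  reachable⇒Ball : ∀ {x u v} k → Ball G x k u → Star (Adj G) u v → ∃[ j ] Ball G x j v
  reachable⇒Ball k u∈ ε        = k , u∈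
  reachable⇒Ball k u∈ (uw ◅ w) = reachable⇒Ball (suc k) (inj₂ (_ , u∈ , uw)) w

  P-free⇒Ball-total : ∀ {n} → ¬ (P n ↪ G) → Connected G → ∀ x y → Ball G x n y
  P-free⇒Ball-total {n} free (_ , conn) x y =
    let k , y∈ = reachable⇒Ball 0 refl (conn x y)
        d , yd , _ = least (λ j → Ball? G x j y) {k} y∈
    in Ball-mono {j = d} (≮⇒≥ λ n<d → free (geodesic⇒P yd (≤-trans (<⇒≤ n<d) (n≤1+n d)))) (proj₁ yd)

-- α-bound n k bounds the independence number of a ball of radius k in a graph
-- omitting K₁,n and K*_n.
α-bound : ℕ → ℕ → ℕ
α-bound n zero    = 1
α-bound n (suc k) = α-bound n k + ramseyNumber n (suc (α-bound n k)) * n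

α-Ball≤ : ∀ {G n} → ¬ (K₁, n ↪ G) → ¬ (K* n ↪ G) → ∀ x k → α≤ G (Ball G x k) (α-bound n k)
α-Ball≤ _ _ x zero [] _ = z≤n
α-Ball≤ _ _ x zero (_ ∷ []) _ = ≤-refl
α-Ball≤ _ _ x zero (_ ∷ _ ∷ _) (refl ∷ refl ∷ _ , ((x≢x , _) ∷ _) ∷ _) = contradiction refl x≢x
α-Ball≤ {G} star pend x (suc k) =
  α-neighbourhood≤ (Ball? G x k) (K₁,-free⇒α-neighbours≤ star) pend (α-Ball≤ star pend x k)

α-bounded : ∀ {G n} → Connected G → ¬ (K₁, n ↪ G) → ¬ (K* n ↪ G) → ¬ (P n ↪ G) → α≤ G U (α-bound n n)
α-bounded {n = n} conn@(r , _) star pend path l (_ , ind) =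
  α-Ball≤ star pend r n l (All.tabulate (λ {y} _ → P-free⇒Ball-total path conn r y) , ind)

-- Partition into at most α pieces

-- The image of an adjacency-preserving map, with only the images of edges as edges;
-- it need not be induced.
homImage : ∀ {F G} (f : Vertex F → Vertex G) → (∀ {i j} → Adj F i j → Adj G (f i) (f j)) → Subgraph G
homImage {F} {G} f hom = record
  { V      = λ x → ∃[ i ] f i ≡ x
  ; E      = λ x y → ∃[ i ] ∃[ j ] Adj F i j × f i ≡ x × f j ≡ y
  ; E-symm = λ (i , j , ij , fi , fj) → j , i , symm F ij , fj , fi
  ; E⇒Adj  = λ { (_ , _ , ij , refl , refl) → hom ij }
  ; E⇒V    = λ (i , _ , _ , fi , _) → i , fi
  }

homImage-≅ : ∀ {F G} (f : Vertex F → Vertex G) (hom : ∀ {i j} → Adj F i j → Adj G (f i) (f j)) →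
  Injective _≡_ _≡_ f → F ≅ homImage {F} {G} f hom
homImage-≅ {F} f hom f-inj = record
  { to        = f
  ; injective = f-inj
  ; image     = λ x → mk⇔ (λ p → p) (λ p → p)
  ; edges     = λ i j → mk⇔ (λ ij → i , j , ij , refl , refl)
      λ (_ , _ , ij , fi , fj) → subst₂ (Adj F) (f-inj fi) (f-inj fj) ij
  }

-- A partition of the vertex set S into k vertex sets of pieces.
record PartitionOf (G : Graph) (S : Pred (Vertex G) 0ℓ) (k : ℕ) : Set₁ where
  field
    member   : Fin k → Subgraph G
    piece    : ∀ a → ∃[ F ] Piece F × F ≅ member a
    inside   : ∀ a {x} → x ∈ V (member a) → S x
    covers   : ∀ {x} → S x → ∃[ a ] x ∈ V (member a)
    disjoint : ∀ {a b} → a ≢ b → ∀ {x} → ¬ (x ∈ V (member a) × x ∈ V (member b))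

module _ {G : Graph} where

  open import Data.List.Membership.DecPropositional (_≟ᶠ_ {order G}) using (_∈?_)

  -- A path v ∷ l whose last vertex is adjacent to v; no condition is put on the
  -- single vertex, where l is empty.
  ClosedPath : Vertex G → List (Vertex G) → Set
  ClosedPath v l = Linked (Adj G) (v ∷ l) × Unique (v ∷ l)
    × (∀ i → suc (toℕ i) ≡ length l → Adj G v (lookup l i))

  -- A piece in G with vertex set q.
  PieceOn : List (Vertex G) → Set₁
  PieceOn q = Σ (Subgraph G) λ H → (∃[ F ] Piece F × F ≅ H) × (∀ {x} → x ∈ V H ⇔ x ∈ˡ q)

  imagePiece : ∀ {F q} → Piece F → (f : Vertex F → Vertex G) →
    (∀ {i j} → Adj F i j → Adj G (f i) (f j)) →
    Injective _≡_ _≡_ f → (∀ {x} → (∃[ i ] f i ≡ x) ⇔ x ∈ˡ q) → PieceOn q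
  imagePiece {F} pc f hom f-inj onto =
    homImage {F} {G} f hom , (F , pc , homImage-≅ {F} {G} f hom f-inj) , onto

  closedPath-cyclic : ∀ {v l} → ClosedPath v l → let q = v ∷ l in
    ∀ {i j} → Adj (C (length q)) i j → Adj G (lookup q i) (lookup q j)
  closedPath-cyclic {v} {l} (linked , _ , closed) (i≢j , e) =
    [ cyclic _ _ i≢j , symm G ∘ cyclic _ _ (i≢j ∘ sym) ]′ e
    where
    q = v ∷ l

    cyclic : ∀ (i j : Fin (length q)) → i ≢ j →
      toℕ j ≡ suc (toℕ i) ⊎ (toℕ i ≡ 0 × suc (toℕ j) ≡ length q) →
      Adj G (lookup q i) (lookup q j)
    cyclic i    j       _   (inj₁ next)       = lookup-consecutive linked i j next
    cyclic zero zero    0≢0 (inj₂ _)          = contradiction refl 0≢0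
    cyclic zero (suc j) _   (inj₂ (_ , last)) = closed j (suc-injective last)

  closedPath⇒piece : ∀ {v} l → ClosedPath v l → PieceOn (v ∷ l)
  closedPath⇒piece {v} [] (_ , unique , _) = imagePiece K₁ (lookup (v ∷ []))
    (λ { {zero} {zero} (0≢0 , _) → contradiction refl 0≢0 })
    (lookup-injective unique) ∃lookup⇔∈
  closedPath⇒piece {v} (w ∷ []) (linked , unique , _) =
    imagePiece K₂ (lookup (v ∷ w ∷ [])) edge (lookup-injective unique) ∃lookup⇔∈
    where
    edge : ∀ {i j} → Adj (K 2) i j → Adj G (lookup (v ∷ w ∷ []) i) (lookup (v ∷ w ∷ []) j)
    edge {zero}     {zero}     (0≢0 , _) = contradiction refl 0≢0
    edge {zero}     {suc zero} _         = lookup-consecutive linked zero (suc zero) refl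
    edge {suc zero} {zero}     _         = symm G (lookup-consecutive linked zero (suc zero) refl)
    edge {suc zero} {suc zero} (1≢1 , _) = contradiction refl 1≢1
  closedPath⇒piece {v} l@(_ ∷ _ ∷ _) closedPath@(_ , unique , _) =
    imagePiece (cycle _ (s≤s (s≤s (s≤s z≤n)))) (lookup (v ∷ l)) (closedPath-cyclic closedPath)
      (lookup-injective unique) ∃lookup⇔∈

  -- The list l is a path of G inside S.
  Path : Pred (Vertex G) 0ℓ → List (Vertex G) → Set
  Path S l = Linked (Adj G) l × Unique l × All S l

  -- Extends a path at its first vertex until no extension inside S is possible.
  -- The fuel suffices because a path has at most as many vertices as G.
  maximalPath : ∀ {S} → Decidable S → ∀ fuel {v l} → Path S (v ∷ l) → order G ≤ fuel + length l →
    ∃[ v′ ] ∃[ l′ ] Path S (v′ ∷ l′) × (∀ {u} → S u → Adj G v′ u → u ∈ˡ v′ ∷ l′)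
  maximalPath S? zero (_ , unique , _) enough =
    contradiction (≤-trans (injective⇒≤ (lookup-injective unique)) enough) 1+n≰n
  maximalPath S? (suc fuel) {v} {l} path@(linked , unique , in-S) enough
    with any? (λ u → S? u ×-dec adj? G v u ×-dec ¬? (u ∈? v ∷ l))
  ... | yes (u , Su , vu , u∉) = maximalPath S? fuel
    (symm G vu ∷ linked , All.tabulate (λ x∈ → λ { refl → u∉ x∈ }) ∷ unique , Su ∷ in-S)
    (≤-trans enough (≤-reflexive (sym (+-suc fuel (length l)))))
  ... | no none = v , l , path , λ {u} Su vu → decidable-stable (u ∈? v ∷ l) λ u∉ → none (u , Su , vu , u∉)

  -- A nonempty set S contains a closed path from some v through all neighbours of
  -- v in S.
  closedNeighbourhoodPath : ∀ {S x} → Decidable S → S x →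
    ∃[ v ] ∃[ l ] ClosedPath v l × All S (v ∷ l) × (∀ {u} → S u → Adj G v u → u ∈ˡ v ∷ l)
  closedNeighbourhoodPath S? Sx
    with maximalPath S? (order G) ([-] , [] ∷ [] , Sx ∷ []) (m≤m+n _ 0)
  ... | v , l , (linked , unique , in-S) , maximal with prefixToLast (adj? G v) l
  ...   | l′ , (_ , refl) , closed , all-neighbours = v , l′ ,
    (Linked-++⁻ˡ (v ∷ l′) linked , AllPairs-++⁻ˡ (v ∷ l′) unique , closed) ,
    ++⁻ˡ (v ∷ l′) in-S ,
    λ Su vu → on-prefix (maximal Su vu) vu
    where
    on-prefix : ∀ {u} → u ∈ˡ v ∷ l → Adj G v u → u ∈ˡ v ∷ l′
    on-prefix (here u≡v) _  = here u≡v
    on-prefix (there u∈) vu = there (all-neighbours u∈ vu)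

  empty-partition : ∀ {S} → (∀ x → ¬ S x) → PartitionOf G S 0
  empty-partition empty = record
    { member   = λ ()
    ; piece    = λ ()
    ; inside   = λ ()
    ; covers   = λ Sx → ⊥-elim (empty _ Sx)
    ; disjoint = λ { {()} }
    }

  extend-partition : ∀ {S k q} (H : Subgraph G) → (∃[ F ] Piece F × F ≅ H) →
    (∀ {x} → x ∈ V H ⇔ x ∈ˡ q) → All S q →
    PartitionOf G (λ x → S x × x ∉ˡ q) k → PartitionOf G S (suc k)
  extend-partition {S} {k} {q} H pc V⇔q in-S rest = record
    { member   = members
    ; piece    = λ { zero → pc ; (suc a) → R.piece a }
    ; inside   = λ { zero x∈ → All.lookup in-S (fwd V⇔q x∈) ; (suc a) x∈ → proj₁ (R.inside a x∈) }
    ; covers   = λ {x} Sx → cover x Sx (x ∈? q)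
    ; disjoint = λ {a} {b} → apart a b
    }
    where
    module R = PartitionOf rest

    members : Fin (suc k) → Subgraph G
    members zero    = H
    members (suc a) = R.member a

    apart : ∀ a b → a ≢ b → ∀ {x} → ¬ (x ∈ V (members a) × x ∈ V (members b))
    apart zero    zero    0≢0 _           = contradiction refl 0≢0
    apart zero    (suc b) _   (x∈H , x∈b) = proj₂ (R.inside b x∈b) (fwd V⇔q x∈H)
    apart (suc a) zero    _   (x∈a , x∈H) = proj₂ (R.inside a x∈a) (fwd V⇔q x∈H)
    apart (suc a) (suc b) a≢b both        = R.disjoint (a≢b ∘ cong suc) both

    cover : ∀ x → S x → Dec (x ∈ˡ q) → ∃[ a ] x ∈ V (members a)
    cover x Sx (yes x∈) = zero , bwd V⇔q x∈
    cover x Sx (no x∉)  = let a , x∈a = R.covers (Sx , x∉) in suc a , x∈a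

  -- Pósa: a set of independence number at most a has a partition into at most a
  -- pieces.
  pósa : ∀ a {S} → Decidable S → α≤ G S a → ∃[ k ] k ≤ a × PartitionOf G S k
  pósa zero S? S≤0 = 0 , z≤n , empty-partition λ x Sx → contradiction (S≤0 (x ∷ []) (Sx ∷ [] , [] ∷ [])) λ ()
  pósa (suc a) {S} S? S≤1+a with any? S?
  ... | no empty = 0 , z≤n , empty-partition λ x Sx → empty (x , Sx)
  ... | yes (_ , Sx) with closedNeighbourhoodPath S? Sx
  ...   | v , l , closed , in-S , absorbs =
    let H , pc , V⇔q = closedPath⇒piece l closed
        k , k≤a , rest = pósa a (λ x → S? x ×-dec ¬? (x ∈? v ∷ l)) rest≤a
    in suc k , s≤s k≤a , extend-partition H pc V⇔q in-S rest
    where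
    rest≤a : α≤ G (λ x → S x × x ∉ˡ v ∷ l) a
    rest≤a I (in-rest , ind) = ≤-pred (S≤1+a (v ∷ I)
      ( All.head in-S ∷ All.map proj₁ in-rest
      , All.map (λ (Su , u∉) → (λ { refl → u∉ (here refl) }) , λ vu → u∉ (absorbs Su vu)) in-rest ∷ ind))

α≤⇒cyclePartition : ∀ {G a} → α≤ G U a → ∃[ k ] k ≤ a × CyclePartition G k
α≤⇒cyclePartition {G} {a} G≤a =
  let k , k≤a , part = pósa {G} a (λ _ → yes tt) G≤a
  in k , k≤a , record
    { cover    = record { member = member part ; piece = piece part ; covers = λ x → covers part tt }
    ; disjoint = disjoint part
    }
  where open PartitionOf

-- The implications between the three conditions

module _ {ℓ} (em : ExcludedMiddle (lsuc 0ℓ ⊔ ℓ)) (𝓗 : Family ℓ) where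

  private
    em₁ : ExcludedMiddle (lsuc 0ℓ)
    em₁ = lowerEM ℓ em

  -- If cc ≤ c on connected 𝓗-free graphs, then a connected graph with more than 2c
  -- vertices off all cycles contains a member of 𝓗.
  unavoidable : ∀ {c} → (∀ G → Connected G → (𝓗 -Free) G → ∃[ k ] k IsCcOf G × k ≤ c) →
    ∀ {G n} → Connected G → (f : Fin n → Vertex G) → Injective _≡_ _≡_ f → (∀ i → OffCycles G (f i)) →
    c * 2 < n → ∃[ H ] H ∈ 𝓗 × H ⊑ G
  unavoidable {c} cc≤ {G} {n} conn f f-inj off c*2<n with em {∃[ H ] H ∈ 𝓗 × H ⊑ G}
  ... | yes found = found
  ... | no none =
    let k , (cover , _) , k≤c = cc≤ G conn λ H H∈ H⊑G → none (H , H∈ , H⊑G)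
    in contradiction (≤-trans (offCycles-count f f-inj off cover) (*-monoˡ-≤ 2 k≤c)) (<⇒≱ c*2<n)

  cp-bounded⇒cc-bounded :
    ∃[ c₂ ] (∀ G → Connected G → (𝓗 -Free) G → ∃[ k ] k IsCpOf G × k ≤ c₂) →
    ∃[ c₁ ] (∀ G → Connected G → (𝓗 -Free) G → ∃[ k ] k IsCcOf G × k ≤ c₁)
  cp-bounded⇒cc-bounded (c , cp≤) = c , λ G conn free →
    let _ , (part , _) , k≤c = cp≤ G conn free
        j , min , j≤k = least (λ _ → em₁) (CyclePartition.cover part)
    in j , min , ≤-trans j≤k k≤c

  cc-bounded⇒unavoidable :
    ∃[ c₁ ] (∀ G → Connected G → (𝓗 -Free) G → ∃[ k ] k IsCcOf G × k ≤ c₁) →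
    ∃[ n ] (2 ≤ n × 𝓗 ≼ ｛ K₁, n ｝ ∪ ｛ K* n ｝ ∪ ｛ P n ｝)
  cc-bounded⇒unavoidable (c , cc≤) = n , s≤s (s≤s z≤n) , below
    where
    n = suc (suc (c * 2))

    large : c * 2 < n
    large = s≤s (n≤1+n _)

    below : 𝓗 ≼ ｛ K₁, n ｝ ∪ ｛ K* n ｝ ∪ ｛ P n ｝
    below _ (inj₁ refl) = unavoidable cc≤ (K₁,-connected n) suc (λ { refl → refl })
      (λ i → leaf⇒offCycles (K₁,-leaf i)) large
    below _ (inj₂ (inj₁ refl)) = unavoidable cc≤ (K*-connected _) (n ↑ʳ_) (λ {i} {j} → ↑ʳ-injective n i j)
      (λ i → leaf⇒offCycles (K*-leaf {n} i)) large
    below _ (inj₂ (inj₂ refl)) = unavoidable cc≤ (P-connected _) (λ i → i) (λ eq → eq) P-offCycles large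

  unavoidable⇒cp-bounded :
    ∃[ n ] (2 ≤ n × 𝓗 ≼ ｛ K₁, n ｝ ∪ ｛ K* n ｝ ∪ ｛ P n ｝) →
    ∃[ c₂ ] (∀ G → Connected G → (𝓗 -Free) G → ∃[ k ] k IsCpOf G × k ≤ c₂)
  unavoidable⇒cp-bounded (n , _ , 𝓗≼) = α-bound n n , λ G conn free →
    let free′ : ∀ F → F ∈ ｛ K₁, n ｝ ∪ ｛ K* n ｝ ∪ ｛ P n ｝ → ¬ (F ↪ G)
        free′ F F∈ F↪G = let H , H∈ , H⊑F = 𝓗≼ F F∈ in free H H∈ (⊑-trans H⊑F (↪⇒⊑ F↪G))
        k , k≤ , part = α≤⇒cyclePartition
          (α-bounded conn (free′ _ (inj₁ refl)) (free′ _ (inj₂ (inj₁ refl))) (free′ _ (inj₂ (inj₂ refl))))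
        j , min , j≤k = least (λ _ → em₁) part
    in j , min , ≤-trans j≤k k≤

theorem1p3 : ∀ {ℓ} → ExcludedMiddle (lsuc 0ℓ ⊔ ℓ) →
    (𝓗 : Family ℓ) → (∀ H → H ∈ 𝓗 → Connected H) →
    let i   = ∃[ c₁ ] (∀ G → Connected G → (𝓗 -Free) G →
                ∃[ k ] k IsCcOf G × k ≤ c₁)
        ii  = ∃[ c₂ ] (∀ G → Connected G → (𝓗 -Free) G →
                ∃[ k ] k IsCpOf G × k ≤ c₂)
        iii = ∃[ n ] (2 ≤ n × 𝓗 ≼ ｛ K₁, n ｝ ∪ ｛ K* n ｝ ∪ ｛ P n ｝)
    in (i ⇔ ii) × (ii ⇔ iii)
theorem1p3 em 𝓗 _ =
  mk⇔ (iii⇒ii ∘ i⇒iii) ii⇒i , mk⇔ (i⇒iii ∘ ii⇒i) iii⇒ii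
  where
  ii⇒i   = cp-bounded⇒cc-bounded em 𝓗
  i⇒iii  = cc-bounded⇒unavoidable em 𝓗
  iii⇒ii = unavoidable⇒cp-bounded em 𝓗
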